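{- Let $I_1, I_2, J$ be positive integers with $J\ge 3$. If $I_1 < I_2$, $H(i,J) \le iJ+1$ for every even $i \in \{I_1, I_1+1,\dots, I_2\}$, and $H(i,J) = iJ$ for every odd $i \in \{I_1,I_1+1, \dots, I_2\}$, then $H(I,J) = IJ$ for every $I \in \{2I_1,2I_1+1, \dots, 2I_2\}$.
   Context: A Golomb ruler is a set $\{a_1,\dots,a_k\}$ of $k$ distinct non-negative integers such that all the differences $a_i-a_j$, $i\neq j$, are distinct. An $(I,J,n)$-DGR is a set of $I$ pairwise disjoint Golomb rulers, each being a $J$-element subset of $\{1,2,\dots,n\}$. For positive integers $I,J$, $H(I,J)$ is the least positive integer $n$ such that there is an $(I,J,n)$-DGR. -}

module Defs where

open import Data.Fin using (Fin)
open import Data.Integer using (_⊖_)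
open import Data.Nat using (ℕ; _≤_)
open import Data.Nat.Properties using (≤-antisym)
open import Data.Product using (_×_; _,_; ∃-syntax)
open import Function.Definitions using (Injective)
open import Relation.Binary.PropositionalEquality using (_≡_; _≢_)

-- A k-element set {a₁, …, aₖ} is given by an injective enumeration of its
-- elements.  Differences are the signed ones, _⊖_ being subtraction of
-- naturals with values in ℤ.
record IsGolomb {k : ℕ} (a : Fin k → ℕ) : Set where
  field
    distinct             : Injective _≡_ _≡_ a
    distinct-differences : ∀ {i j i′ j′} → i ≢ j → i′ ≢ j′ →
                           a i ⊖ a j ≡ a i′ ⊖ a j′ → i ≡ i′ × j ≡ j′

-- For J ≥ 1 disjointness makes the I rulers distinct, so that the family is
-- indeed a set of I rulers.
record IsDGR (I J n : ℕ) (r : Fin I → Fin J → ℕ) : Set where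
  field
    golomb   : ∀ s → IsGolomb (r s)
    range    : ∀ s i → 1 ≤ r s i × r s i ≤ n
    disjoint : ∀ {s t} → s ≢ t → ∀ i j → r s i ≢ r t j

DGR : (I J n : ℕ) → Set
DGR I J n = ∃[ r ] IsDGR I J n r

-- IsH I J h is the graph of H, "H(I,J) = h".
record IsH (I J h : ℕ) : Set where
  field
    positive : 1 ≤ h
    exists   : DGR I J h
    least    : ∀ n → 1 ≤ n → DGR I J n → h ≤ n

IsH-unique : ∀ {I J h h′} → IsH I J h → IsH I J h′ → h ≡ h′
IsH-unique p q = ≤-antisym (P.least _ Q.positive Q.exists)
                           (Q.least _ P.positive P.exists)
  where
  module P = IsH p
  module Q = IsH q

{-# OPTIONS --safe #-}
-- A Golomb ruler cut into a lower and an upper part stays Golomb when the upper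
-- part is moved up, provided that the new gap exceeds the differences inside
-- both parts.  Hence two families can be interlaced: cut each of them as A ∪ B
-- and A′ ∪ B′, and arrange the pieces in the order A, A′, B, B′.  An
-- (i, J, iJ+1)-DGR misses a point, and cutting it there makes the missing point
-- disappear.  Interlacing it with its mirror image gives H(2i,J) = 2iJ.
-- Interlacing it with a perfect (j, J, jJ)-DGR gives H(i+j,J) = (i+j)J: either
-- the whole perfect family is inserted at the missing point, or, when one side
-- of that point is longer than jJ+1, only the first element of the perfect
-- family is placed there and the rest goes beyond the longer side.
module Submission where

import Algebra.Properties.AbelianGroup
open import Data.Empty using (⊥-elim)
open import Data.Fin using (Fin; toℕ; fromℕ<; splitAt; combine; remQuot)
open import Data.Fin.Properties as Fin
  using (any?; ¬∀⟶∃¬; injective⇒≤; toℕ-injective; toℕ<n; fromℕ<-injective;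
         splitAt⁻¹-↑ˡ; splitAt⁻¹-↑ʳ; combine-remQuot)
open import Data.Integer as ℤ using (_⊖_)
import Data.Integer.Properties as ℤ
open Algebra.Properties.AbelianGroup ℤ.+-0-abelianGroup using (∙-cancelʳ)
open import Data.Nat
  using (ℕ; zero; suc; _+_; _*_; _∸_; _≤_; _<_; z≤n; s≤s; s≤s⁻¹; _≤?_)
open import Data.Nat.Divisibility using (_∣_; _∤_; _∣?_; ∣m+n∣m⇒∣n; ∣1⇒≡1)
open import Data.Nat.Properties
open import Data.Nat.Tactic.RingSolver using (solve-∀)
open import Data.Product using (_×_; _,_; ∃-syntax; proj₁; proj₂; uncurry)
open import Data.Sum using (_⊎_; inj₁; inj₂; [_,_]′)
open import Function.Definitions using (Injective)
open import Relation.Binary.Definitions using (tri<; tri≈; tri>)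
open import Relation.Binary.PropositionalEquality
open import Relation.Nullary using (¬_; yes; no)
open import Defs

-- Differences and sums

-- Moving `b` and `d` across turns equal differences into equal sums of naturals, so that all later
-- estimates stay in ℕ.
⊖≡⇒+≡ : ∀ a b c d → a ⊖ b ≡ c ⊖ d → a + d ≡ c + b
⊖≡⇒+≡ a b c d eq = ℤ.+-injective (∙-cancelʳ (ℤ.- (ℤ.+ (b + d))) _ _ (begin
  ℤ.+ (a + d) ℤ.+ ℤ.- (ℤ.+ (b + d)) ≡⟨ ℤ.m-n≡m⊖n (a + d) (b + d) ⟩
  (a + d) ⊖ (b + d)                 ≡⟨ cong₂ _⊖_ (+-comm a d) (+-comm b d) ⟩
  (d + a) ⊖ (d + b)                 ≡⟨ ℤ.+-cancelˡ-⊖ d a b ⟩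
  a ⊖ b                             ≡⟨ eq ⟩
  c ⊖ d                             ≡⟨ ℤ.+-cancelˡ-⊖ b c d ⟨
  (b + c) ⊖ (b + d)                 ≡⟨ cong (_⊖ (b + d)) (+-comm b c) ⟩
  (c + b) ⊖ (b + d)                 ≡⟨ ℤ.m-n≡m⊖n (c + b) (b + d) ⟨
  ℤ.+ (c + b) ℤ.+ ℤ.- (ℤ.+ (b + d)) ∎))
  where open ≡-Reasoning

+≡⇒⊖≡ : ∀ a b c d → a + d ≡ c + b → a ⊖ b ≡ c ⊖ d
+≡⇒⊖≡ a b c d eq = begin
  a ⊖ b             ≡⟨ ℤ.+-cancelˡ-⊖ d a b ⟨
  (d + a) ⊖ (d + b) ≡⟨ cong₂ _⊖_ (trans (+-comm d a) (trans eq (+-comm c b))) (+-comm d b) ⟩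
  (b + c) ⊖ (b + d) ≡⟨ ℤ.+-cancelˡ-⊖ b c d ⟩
  c ⊖ d             ∎
  where open ≡-Reasoning

-- Transfer and union of families

IsGolomb-transfer : ∀ {k} {a a′ : Fin k → ℕ} →
  (∀ i j i′ j′ → a′ i + a′ j′ ≡ a′ i′ + a′ j → a i + a j′ ≡ a i′ + a j) →
  IsGolomb a → IsGolomb a′
IsGolomb-transfer {a = a} {a′} reflects g = record
  { distinct = λ {i} {j} eq → IsGolomb.distinct g
      (+-cancelʳ-≡ (a i) _ _ (reflects i i j i (cong (_+ a′ i) eq)))
  ; distinct-differences = λ {i} {j} {i′} {j′} i≢j i′≢j′ eq →
      IsGolomb.distinct-differences g i≢j i′≢j′
        (+≡⇒⊖≡ (a i) (a j) (a i′) (a j′)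
          (reflects i j i′ j′ (⊖≡⇒+≡ (a′ i) (a′ j) (a′ i′) (a′ j′) eq)))
  }

-- Every move of a family is checked through one implication between sums. The four elements may
-- come from different rulers because disjointness is read off from it too: two equal elements, with
-- a common summand added on both sides, form such an equation.
IsDGR-transfer : ∀ {I J n n′} {r r′ : Fin I → Fin J → ℕ} →
  (∀ s i t j s′ i′ t′ j′ → r′ s i + r′ t′ j′ ≡ r′ s′ i′ + r′ t j →
                           r s i + r t′ j′ ≡ r s′ i′ + r t j) →
  (∀ s i → 1 ≤ r′ s i × r′ s i ≤ n′) →
  IsDGR I J n r → IsDGR I J n′ r′
IsDGR-transfer {r = r} {r′} reflects range d = record
  { golomb   = λ s → IsGolomb-transfer
      (λ i j i′ j′ → reflects s i s j s i′ s j′) (IsDGR.golomb d s)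
  ; range    = range
  ; disjoint = λ {s} {t} s≢t i j eq → IsDGR.disjoint d s≢t i j
      (+-cancelʳ-≡ (r s i) _ _ (reflects s i s i t j s i (cong (_+ r′ s i) eq)))
  }

IsDGR-weaken : ∀ {I J n n′ r} → n ≤ n′ → IsDGR I J n r → IsDGR I J n′ r
IsDGR-weaken n≤n′ d = IsDGR-transfer (λ _ _ _ _ _ _ _ _ eq → eq)
  (λ s i → proj₁ (IsDGR.range d s i) , ≤-trans (proj₂ (IsDGR.range d s i)) n≤n′) d

IsDGR-union : ∀ {I₁ I₂ J n r₁ r₂} → IsDGR I₁ J n r₁ → IsDGR I₂ J n r₂ →
  (∀ s i t j → r₁ s i ≢ r₂ t j) → DGR (I₁ + I₂) J n
IsDGR-union {I₁} {I₂} {J} {n} {r₁} {r₂} d₁ d₂ apart = r , record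
  { golomb = golomb ; range = range ; disjoint = disjoint }
  where
  module D₁ = IsDGR d₁
  module D₂ = IsDGR d₂

  r : Fin (I₁ + I₂) → Fin J → ℕ
  r s = [ r₁ , r₂ ]′ (splitAt I₁ s)

  golomb : ∀ s → IsGolomb (r s)
  golomb s with splitAt I₁ s
  ... | inj₁ s₁ = D₁.golomb s₁
  ... | inj₂ s₂ = D₂.golomb s₂

  range : ∀ s i → 1 ≤ r s i × r s i ≤ n
  range s i with splitAt I₁ s
  ... | inj₁ s₁ = D₁.range s₁ i
  ... | inj₂ s₂ = D₂.range s₂ i

  disjoint : ∀ {s t} → s ≢ t → ∀ i j → r s i ≢ r t j
  disjoint {s} {t} s≢t i j with splitAt I₁ s in eqₛ | splitAt I₁ t in eqₜ
  ... | inj₁ s₁ | inj₂ t₂ = apart s₁ i t₂ j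
  ... | inj₂ s₂ | inj₁ t₁ = λ eq → apart t₁ j s₂ i (sym eq)
  ... | inj₁ s₁ | inj₁ t₁ = D₁.disjoint
    (λ { refl → s≢t (trans (sym (splitAt⁻¹-↑ˡ eqₛ)) (splitAt⁻¹-↑ˡ eqₜ)) }) i j
  ... | inj₂ s₂ | inj₂ t₂ = D₂.disjoint
    (λ { refl → s≢t (trans (sym (splitAt⁻¹-↑ʳ {m = I₁} eqₛ)) (splitAt⁻¹-↑ʳ {m = I₁} eqₜ)) }) i j

-- Widening a gap

-- u lies in the lower part {1,…,α} or, beyond a gap of h integers, in the upper
-- part, which has room for β elements.
data Split (α h β u : ℕ) : Set where
  low  : 1 ≤ u → u ≤ α → Split α h β u
  high : α + h < u → u ≤ α + h + β → Split α h β u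

offset : ∀ {α h β u} → ℕ → Split α h β u → ℕ
offset L (low _ _)  = 0
offset L (high _ _) = L

place : ∀ {α h β u} → ℕ → Split α h β u → ℕ
place {u = u} L p = offset L p + u

-- After the shift by L the smallest difference across the gap is L + h + 1; it
-- has to exceed α − 1 and β − 1.
Spread : (α h β L : ℕ) → Set
Spread α h β L = L ≡ 0 ⊎ (α ≤ suc (L + h) × β ≤ suc (L + h))

offset-zero : ∀ {α h β u} (p : Split α h β u) → offset 0 p ≡ 0
offset-zero (low _ _)  = refl
offset-zero (high _ _) = refl

-- Settles the configurations in which both sides are shifted by the same total amount.
offset-cancel : ∀ {u v u′ v′} o o₁ o₂ o₃ → o + o₃ ≡ o₂ + o₁ →
  (o + u) + (o₃ + v′) ≡ (o₂ + u′) + (o₁ + v) → u + v′ ≡ u′ + v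
offset-cancel {u} {v} {u′} {v′} o o₁ o₂ o₃ offsets eq =
  +-cancelˡ-≡ (o + o₃) _ _ (begin
    o + o₃ + (u + v′)     ≡⟨ shuffle o o₃ u v′ ⟩
    (o + u) + (o₃ + v′)   ≡⟨ eq ⟩
    (o₂ + u′) + (o₁ + v)  ≡⟨ shuffle o₂ o₁ u′ v ⟨
    o₂ + o₁ + (u′ + v)    ≡⟨ cong (_+ (u′ + v)) offsets ⟨
    o + o₃ + (u′ + v)     ∎)
  where
  open ≡-Reasoning
  shuffle : ∀ a b x y → a + b + (x + y) ≡ (a + x) + (b + y)
  shuffle = solve-∀

module _ {α h β L : ℕ} (α≤ : α ≤ suc (L + h)) (β≤ : β ≤ suc (L + h)) where

  private
    G : ℕ
    G = L + h

  open ≤-Reasoning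

  -- Only differences leading from the lower part up to the shifted upper part exceed `G`; all other
  -- signed differences, treated in the next three lemmas, are at most `G`.
  high-low-far : ∀ {u v} → α + h < u → v ≤ α → v + suc G ≤ L + u
  high-low-far {u} {v} α+h<u v≤α = begin
    v + suc (L + h)  ≤⟨ +-monoˡ-≤ (suc G) v≤α ⟩
    α + suc (L + h)  ≡⟨ shuffle α L h ⟩
    L + suc (α + h)  ≤⟨ +-monoʳ-≤ L α+h<u ⟩
    L + u            ∎
    where
    shuffle : ∀ α L h → α + suc (L + h) ≡ L + suc (α + h)
    shuffle = solve-∀

  low-low-near : ∀ {u v} → u ≤ α → 1 ≤ v → u ≤ v + G
  low-low-near u≤α 1≤v = ≤-trans u≤α (≤-trans α≤ (+-monoˡ-≤ G 1≤v))

  low-high-near : ∀ {u v} → u ≤ α → α + h < v → u ≤ (L + v) + G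
  low-high-near {u} {v} u≤α α+h<v = begin
    u            ≤⟨ u≤α ⟩
    α            ≤⟨ m≤m+n α h ⟩
    α + h        ≤⟨ <⇒≤ α+h<v ⟩
    v            ≤⟨ m≤n+m v L ⟩
    L + v        ≤⟨ m≤m+n (L + v) G ⟩
    (L + v) + G  ∎

  high-high-near : ∀ {u v} → u ≤ α + h + β → α + h < v → L + u ≤ (L + v) + G
  high-high-near {u} {v} u≤ α+h<v = begin
    L + u                 ≤⟨ +-monoʳ-≤ L u≤ ⟩
    L + (α + h + β)       ≤⟨ +-monoʳ-≤ L (+-monoʳ-≤ (α + h) β≤) ⟩
    L + (α + h + suc G)   ≡⟨ cong (L +_) (+-suc (α + h) G) ⟩
    L + (suc (α + h) + G) ≤⟨ +-monoʳ-≤ L (+-monoˡ-≤ G α+h<v) ⟩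
    L + (v + G)           ≡⟨ +-assoc L v G ⟨
    (L + v) + G           ∎

  far≢near : ∀ {x y x′ y′} → y + suc G ≤ x → x′ ≤ y′ + G → x + y′ ≢ x′ + y
  far≢near {x} {y} {x′} {y′} far near eq = <-irrefl (sym eq) (begin-strict
    x′ + y         ≤⟨ +-monoˡ-≤ y near ⟩
    y′ + G + y     <⟨ n<1+n _ ⟩
    suc (y′ + G + y) ≡⟨ shuffle y′ G y ⟩
    y + suc G + y′ ≤⟨ +-monoˡ-≤ y′ far ⟩
    x + y′         ∎)
    where
    shuffle : ∀ a g b → suc (a + g + b) ≡ b + suc g + a
    shuffle = solve-∀

  -- In six of the sixteen cases the total offsets agree and cancel. In the other ten just one
  -- difference crosses the gap, or the two cross it in opposite directions; up to sign, a
  -- difference beyond `G` would then equal one of at most `G`.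
  place-reflects-wide : ∀ {u v u′ v′} (p : Split α h β u) (q : Split α h β v)
    (p′ : Split α h β u′) (q′ : Split α h β v′) →
    place L p + place L q′ ≡ place L p′ + place L q → u + v′ ≡ u′ + v
  place-reflects-wide (low _ _) (low _ _) (low _ _) (low _ _) eq = eq
  place-reflects-wide {u} {v} {u′} {v′} (low _ _) (low _ _) (high _ _) (high _ _) eq =
    offset-cancel {u} {v} {u′} {v′} 0 0 L L (sym (+-identityʳ L)) eq
  place-reflects-wide {u} {v} {u′} {v′} (high _ _) (high _ _) (low _ _) (low _ _) eq =
    offset-cancel {u} {v} {u′} {v′} L L 0 0 (+-identityʳ L) eq
  place-reflects-wide (high _ _) (high _ _) (high _ _) (high _ _) eq =
    offset-cancel L L L L refl eq
  place-reflects-wide (high _ _) (low _ _) (high _ _) (low _ _) eq =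
    offset-cancel L 0 L 0 refl eq
  place-reflects-wide {u} {v} {u′} {v′} (low _ _) (high _ _) (low _ _) (high _ _) eq =
    offset-cancel {u} {v} {u′} {v′} 0 L 0 L refl eq
  place-reflects-wide (high a _) (low _ b) (low _ a′) (low b′ _) eq =
    ⊥-elim (far≢near (high-low-far a b) (low-low-near a′ b′) eq)
  place-reflects-wide (high a _) (low _ b) (low _ a′) (high b′ _) eq =
    ⊥-elim (far≢near (high-low-far a b) (low-high-near a′ b′) eq)
  place-reflects-wide (high a _) (low _ b) (high _ a′) (high b′ _) eq =
    ⊥-elim (far≢near (high-low-far a b) (high-high-near a′ b′) eq)
  place-reflects-wide (low _ a′) (low b′ _) (high a _) (low _ b) eq =
    ⊥-elim (far≢near (high-low-far a b) (low-low-near a′ b′) (sym eq))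
  place-reflects-wide (low _ a′) (high b′ _) (high a _) (low _ b) eq =
    ⊥-elim (far≢near (high-low-far a b) (low-high-near a′ b′) (sym eq))
  place-reflects-wide (high _ a′) (high b′ _) (high a _) (low _ b) eq =
    ⊥-elim (far≢near (high-low-far a b) (high-high-near a′ b′) (sym eq))
  -- In the last four cases the crossing difference leads downwards; negating both differences
  -- brings it into the form of `far≢near`.
  place-reflects-wide {u} {v} {u′} {v′} (low _ b) (high a _) (low b′ _) (low _ a′) eq =
    ⊥-elim (far≢near (high-low-far a b) (low-low-near a′ b′)
      (trans (+-comm (L + v) u′) (trans (sym eq) (+-comm u v′))))
  place-reflects-wide {u} {v} {u′} {v′} (low _ b) (high a _) (high b′ _) (high _ a′) eq =
    ⊥-elim (far≢near (high-low-far a b) (high-high-near a′ b′)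
      (trans (+-comm (L + v) (L + u′)) (trans (sym eq) (+-comm u (L + v′)))))
  place-reflects-wide {u} {v} {u′} {v′} (low b′ _) (low _ a′) (low _ b) (high a _) eq =
    ⊥-elim (far≢near (high-low-far a b) (low-low-near a′ b′)
      (trans (+-comm (L + v′) u) (trans eq (+-comm u′ v))))
  place-reflects-wide {u} {v} {u′} {v′} (high b′ _) (high _ a′) (low _ b) (high a _) eq =
    ⊥-elim (far≢near (high-low-far a b) (high-high-near a′ b′)
      (trans (+-comm (L + v′) (L + u)) (trans eq (+-comm u′ (L + v)))))

place-reflects : ∀ {α h β L} → Spread α h β L → ∀ {u v u′ v′}
  (p : Split α h β u) (q : Split α h β v) (p′ : Split α h β u′) (q′ : Split α h β v′) →
  place L p + place L q′ ≡ place L p′ + place L q → u + v′ ≡ u′ + v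
place-reflects (inj₂ (α≤ , β≤)) = place-reflects-wide α≤ β≤
-- With `L` = 0 every offset is 0, so the offsets always balance.
place-reflects (inj₁ refl) p q p′ q′ =
  offset-cancel (offset 0 p) (offset 0 q) (offset 0 p′) (offset 0 q′)
    (cong₂ _+_ (trans (offset-zero p) (sym (offset-zero p′)))
               (trans (offset-zero q′) (sym (offset-zero q))))

-- Interlacing

-- The order A, A′, B, B′: A′ fills the widened gap of the first family, and B
-- fills that of the second.
interlace : ∀ {I₁ I₂ J n₁ n₂ r₁ r₂} {α h β α′ h′ β′ : ℕ} L₁ L₂ →
  L₁ + h ≡ α′ → L₂ + h′ ≡ β →
  Spread α h β L₁ → Spread α′ h′ β′ L₂ →
  IsDGR I₁ J n₁ r₁ → (∀ s i → Split α h β (r₁ s i)) →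
  IsDGR I₂ J n₂ r₂ → (∀ s i → Split α′ h′ β′ (r₂ s i)) →
  DGR (I₁ + I₂) J (α + α′ + β + β′)
interlace {α = α} {h} {_} {_} {h′} {β′} L₁ L₂ refl refl spread₁ spread₂ d₁ split₁ d₂ split₂ =
  IsDGR-union
    (IsDGR-transfer
      (λ s i t j s′ i′ t′ j′ →
        place-reflects spread₁ (split₁ s i) (split₁ t j) (split₁ s′ i′) (split₁ t′ j′))
      (λ s i → range₁ (split₁ s i)) d₁)
    (IsDGR-transfer
      (λ s i t j s′ i′ t′ j′ eq →
        place-reflects spread₂ (split₂ s i) (split₂ t j) (split₂ s′ i′) (split₂ t′ j′)
          -- The second family is also translated by `α` as a whole, to make room for A; this
          -- constant cancels.
          (offset-cancel α α α α refl eq))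
      (λ s i → range₂ (split₂ s i)) d₂)
    (λ s i t j → apart (split₁ s i) (split₂ t j))
  where
  open ≤-Reasoning
  α′ β n : ℕ
  α′ = L₁ + h
  β  = L₂ + h′
  n  = α + α′ + β + β′

  shuffle : ∀ a l k → a + (l + k) ≡ l + (a + k)
  shuffle = solve-∀

  -- A, A′, B, B′ fit into consecutive intervals ending at `α`, `α + α′`, `α + α′ + β` and `n`; the
  -- bounds below place the two shifted upper parts.
  high₁-lower : ∀ {u} → α + h < u → α + α′ < L₁ + u
  high₁-lower {u} α+h<u = begin-strict
    α + (L₁ + h)  ≡⟨ shuffle α L₁ h ⟩
    L₁ + (α + h)  <⟨ +-monoʳ-< L₁ α+h<u ⟩
    L₁ + u        ∎

  high₁-upper : ∀ {u} → u ≤ α + h + β → L₁ + u ≤ α + α′ + β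
  high₁-upper {u} u≤ = begin
    L₁ + u              ≤⟨ +-monoʳ-≤ L₁ u≤ ⟩
    L₁ + (α + h + β)    ≡⟨ +-assoc L₁ (α + h) β ⟨
    L₁ + (α + h) + β    ≡⟨ cong (_+ β) (shuffle α L₁ h) ⟨
    α + (L₁ + h) + β    ∎

  high₂-lower : ∀ {v} → α′ + h′ < v → α + α′ + β < α + (L₂ + v)
  high₂-lower {v} α′+h′<v = begin-strict
    α + α′ + (L₂ + h′)    ≡⟨ +-assoc α α′ β ⟩
    α + (α′ + (L₂ + h′))  ≡⟨ cong (α +_) (shuffle α′ L₂ h′) ⟩
    α + (L₂ + (α′ + h′))  <⟨ +-monoʳ-< α (+-monoʳ-< L₂ α′+h′<v) ⟩
    α + (L₂ + v)          ∎

  high₂-upper : ∀ {v} → v ≤ α′ + h′ + β′ → α + (L₂ + v) ≤ n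
  high₂-upper {v} v≤ = begin
    α + (L₂ + v)                ≤⟨ +-monoʳ-≤ α (+-monoʳ-≤ L₂ v≤) ⟩
    α + (L₂ + (α′ + h′ + β′))   ≡⟨ regroup α α′ L₂ h′ β′ ⟩
    α + α′ + (L₂ + h′) + β′     ∎
    where
    regroup : ∀ a a′ l k b → a + (l + (a′ + k + b)) ≡ a + a′ + (l + k) + b
    regroup = solve-∀

  α≤n : α ≤ n
  α≤n = ≤-trans (m≤m+n α α′) (≤-trans (m≤m+n (α + α′) β) (m≤m+n (α + α′ + β) β′))

  α+α′≤n : α + α′ ≤ n
  α+α′≤n = ≤-trans (m≤m+n (α + α′) β) (m≤m+n (α + α′ + β) β′)

  range₁ : ∀ {u} (p : Split α h β u) → 1 ≤ place L₁ p × place L₁ p ≤ n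
  range₁ (low 1≤u u≤α) = 1≤u , ≤-trans u≤α α≤n
  range₁ (high lo up) = ≤-trans (s≤s z≤n) (high₁-lower lo)
                      , ≤-trans (high₁-upper up) (m≤m+n _ β′)

  range₂ : ∀ {v} (q : Split α′ h′ β′ v) → 1 ≤ α + place L₂ q × α + place L₂ q ≤ n
  range₂ (low 1≤v v≤α′) = ≤-trans 1≤v (m≤n+m _ α)
                        , ≤-trans (+-monoʳ-≤ α v≤α′) α+α′≤n
  range₂ (high lo up) = ≤-trans (s≤s z≤n) (high₂-lower lo) , high₂-upper up

  apart : ∀ {u v} (p : Split α h β u) (q : Split α′ h′ β′ v) →
    place L₁ p ≢ α + place L₂ q
  apart (low _ u≤α) (low 1≤v _) = <⇒≢ (begin-strict
    _      ≤⟨ u≤α ⟩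
    α      <⟨ m<m+n α 1≤v ⟩
    α + _  ∎)
  apart (low _ u≤α) (high lo _) = <⇒≢ (≤-<-trans u≤α
    (≤-<-trans (≤-trans (m≤m+n α α′) (m≤m+n _ β)) (high₂-lower lo)))
  apart (high lo _) (low _ v≤α′) = ≢-sym (<⇒≢ (≤-<-trans (+-monoʳ-≤ α v≤α′) (high₁-lower lo)))
  apart (high _ up) (high lo _) = <⇒≢ (≤-<-trans (high₁-upper up) (high₂-lower lo))

-- Missing points and mirror images

encode : ∀ {I J n r} → IsDGR I J n r → Fin (I * J) → ℕ
encode {J = J} {r = r} _ x = uncurry r (remQuot J x)

encode-injective : ∀ {I J n r} (d : IsDGR I J n r) → Injective _≡_ _≡_ (encode d)
encode-injective {I} {J} {r = r} d {x} {y} eq = begin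
  x                                ≡⟨ combine-remQuot {I} J x ⟨
  uncurry combine (remQuot {I} J x) ≡⟨ cong (uncurry combine) (same _ _ eq) ⟩
  uncurry combine (remQuot {I} J y) ≡⟨ combine-remQuot {I} J y ⟩
  y                                ∎
  where
  open ≡-Reasoning
  same : ∀ (x y : Fin I × Fin J) → uncurry r x ≡ uncurry r y → x ≡ y
  same (s , i) (t , j) eq with s Fin.≟ t
  ... | yes refl = cong (s ,_) (IsGolomb.distinct (IsDGR.golomb d s) eq)
  ... | no s≢t   = ⊥-elim (IsDGR.disjoint d s≢t i j eq)

-- The trivial lower bound for H, by pigeonhole. Elements are at least 1, so lowering them by 1 to
-- land in `Fin n` loses nothing.
I*J≤n : ∀ {I J n} → DGR I J n → I * J ≤ n
I*J≤n {I} {J} {n} (r , d) = injective⇒≤ {f = λ x → fromℕ< (bound x)} λ {x} {y} eq →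
  encode-injective d (∸-cancelʳ-≡ (positive x) (positive y)
    (fromℕ<-injective _ _ (bound x) (bound y) eq))
  where
  positive : ∀ x → 1 ≤ encode d x
  positive x = proj₁ (uncurry (IsDGR.range d) (remQuot J x))

  bound : ∀ x → encode d x ∸ 1 < n
  bound x = subst (_≤ n) (sym (m+[n∸m]≡n (positive x)))
                  (proj₂ (uncurry (IsDGR.range d) (remQuot J x)))

insert-one : ∀ k l {m} → k + l ≡ m → m + 1 ≡ k + 1 + l
insert-one k l refl = shuffle k l
  where
  shuffle : ∀ k l → k + l + 1 ≡ k + 1 + l
  shuffle = solve-∀

-- By pigeonhole some point `k + 1` is missed; it becomes a gap of width 1. It may be an end point,
-- in which case `k` or `l` is 0.
missing-point : ∀ {I J r} → IsDGR I J (I * J + 1) r →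
  ∃[ k ] ∃[ l ] (k + l ≡ I * J × (∀ s i → Split k 1 l (r s i)))
missing-point {I} {J} {r} d = k , l , k+l≡ , λ s i → split s i (<-cmp (r s i) (suc k))
  where
  M : ℕ
  M = I * J + 1

  Hit : Fin M → Set
  Hit x = ∃[ y ] encode d y ≡ suc (toℕ x)

  not-all-hit : ¬ (∀ x → Hit x)
  not-all-hit hit = <-irrefl refl (subst (_≤ I * J) (+-comm (I * J) 1)
    (injective⇒≤ {f = λ x → proj₁ (hit x)} λ {x} {y} eq →
      toℕ-injective (suc-injective
        (trans (sym (proj₂ (hit x))) (trans (cong (encode d) eq) (proj₂ (hit y)))))))

  missed : ∃[ x ] ¬ Hit x
  -- Being hit is decidable by a finite search, so the failure of surjectivity yields an actual
  -- point.
  missed = ¬∀⟶∃¬ M Hit (λ x → any? λ y → encode d y ≟ suc (toℕ x)) not-all-hit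

  k l : ℕ
  k = toℕ (proj₁ missed)
  l = I * J ∸ k

  k+l≡ : k + l ≡ I * J
  k+l≡ = m+[n∸m]≡n (s≤s⁻¹ (subst (k <_) (+-comm (I * J) 1) (toℕ<n (proj₁ missed))))

  split : ∀ s i → _ → Split k 1 l (r s i)
  split s i (tri< r<x _ _) = low (proj₁ (IsDGR.range d s i)) (s≤s⁻¹ r<x)
  split s i (tri> _ _ x<r) = high (subst (_< r s i) (+-comm 1 k) x<r)
                                  (subst (r s i ≤_) (insert-one k l k+l≡) (proj₂ (IsDGR.range d s i)))
  split s i (tri≈ _ r≡x _) = ⊥-elim (proj₂ missed
    (combine s i , trans (cong (uncurry r) (Fin.remQuot-combine s i)) r≡x))

-- Reflection negates all differences. Each element and its image add up to `n + 1`, which lets the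
-- argument avoid truncated subtraction.
IsDGR-mirror : ∀ {I J n r} → IsDGR I J n r → IsDGR I J n (λ s i → suc n ∸ r s i)
IsDGR-mirror {n = n} {r} d = IsDGR-transfer reflects range d
  where
  complement : ∀ s i → r s i + (suc n ∸ r s i) ≡ suc n
  complement s i = m+[n∸m]≡n (m≤n⇒m≤1+n (proj₂ (IsDGR.range d s i)))

  swap-sums : ∀ {N a a′ b b′ c c′ e e′} →
    a + a′ ≡ N → b + b′ ≡ N → c + c′ ≡ N → e + e′ ≡ N →
    a′ + b′ ≡ c′ + e′ → a + b ≡ c + e
  swap-sums {N} {a} {a′} {b} {b′} {c} {c′} {e} {e′} a≡ b≡ c≡ e≡ eq =
    +-cancelʳ-≡ (a′ + b′) _ _ (begin
      (a + b) + (a′ + b′)   ≡⟨ shuffle a b a′ b′ ⟩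
      (a + a′) + (b + b′)   ≡⟨ cong₂ _+_ (trans a≡ (sym c≡)) (trans b≡ (sym e≡)) ⟩
      (c + c′) + (e + e′)   ≡⟨ shuffle c e c′ e′ ⟨
      (c + e) + (c′ + e′)   ≡⟨ cong ((c + e) +_) eq ⟨
      (c + e) + (a′ + b′)   ∎)
    where
    open ≡-Reasoning
    shuffle : ∀ a b x y → (a + b) + (x + y) ≡ (a + x) + (b + y)
    shuffle = solve-∀

  reflects : ∀ s i t j s′ i′ t′ j′ → _ → r s i + r t′ j′ ≡ r s′ i′ + r t j
  reflects s i t j s′ i′ t′ j′ =
    swap-sums {a = r s i} {b = r t′ j′} {c = r s′ i′} {e = r t j}
      (complement s i) (complement t′ j′) (complement s′ i′) (complement t j)

  range : ∀ s i → 1 ≤ suc n ∸ r s i × suc n ∸ r s i ≤ n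
  range s i = m<n⇒0<n∸m (s≤s (proj₂ (IsDGR.range d s i)))
            , ∸-monoʳ-≤ (suc n) (proj₁ (IsDGR.range d s i))

Split-mirror : ∀ {α h β u n} → n ≡ α + h + β → Split α h β u → Split β h α (suc n ∸ u)
Split-mirror {α} {h} {β} {u} refl (low 1≤u u≤α) = high
  (m+n≤o⇒m≤o∸n (suc (β + h)) (begin
    suc (β + h) + u     ≤⟨ +-monoʳ-≤ (suc (β + h)) u≤α ⟩
    suc (β + h) + α     ≡⟨ shuffle α h β ⟩
    suc (α + h + β)     ∎))
  (≤-trans (∸-monoʳ-≤ (suc (α + h + β)) 1≤u) (≤-reflexive (sym (suc-injective (shuffle α h β)))))
  where
  open ≤-Reasoning
  shuffle : ∀ a h b → suc (b + h) + a ≡ suc (a + h + b)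
  shuffle = solve-∀
Split-mirror {α} {h} {β} {u} refl (high lo up) = low
  (m<n⇒0<n∸m (s≤s up))
  (m≤n+o⇒m∸n≤o _ u (+-monoˡ-≤ β lo))

-- Combining families

-- The longer parts go inside: both gaps are then widened from 1 to `l`, the length of the longest
-- part, as `Spread` demands. With the longer parts outside they would only reach `k`.
IsDGR-double-short-low : ∀ {I J n n′ r r′ k l} → 1 ≤ l → k ≤ l →
  IsDGR I J n r → (∀ s i → Split k 1 l (r s i)) →
  IsDGR I J n′ r′ → (∀ s i → Split l 1 k (r′ s i)) →
  DGR (I + I) J (k + l + l + k)
IsDGR-double-short-low {k = k} {l} 1≤l k≤l d split d′ split′ =
  interlace (l ∸ 1) (l ∸ 1) gap gap
    (inj₂ (below k≤l , below ≤-refl)) (inj₂ (below ≤-refl , below k≤l))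
    d split d′ split′
  where
  gap : l ∸ 1 + 1 ≡ l
  gap = m∸n+n≡m 1≤l

  below : ∀ {m} → m ≤ l → m ≤ suc (l ∸ 1 + 1)
  below m≤l = ≤-trans m≤l (≤-trans (≤-reflexive (sym gap)) (n≤1+n _))

DGR-double : ∀ {I J} → 1 ≤ I * J → DGR I J (I * J + 1) → DGR (I + I) J ((I + I) * J)
DGR-double {I} {J} 1≤IJ (r , d) with missing-point d
... | k , l , k+l≡IJ , split = by-cases (≤-total k l)
  where
  total : ∀ k l → k + l ≡ I * J → k + l + l + k ≡ (I + I) * J
  total k l eq = begin
    k + l + l + k      ≡⟨ regroup k l ⟩
    (k + l) + (k + l)  ≡⟨ cong₂ _+_ eq eq ⟩
    I * J + I * J      ≡⟨ *-distribʳ-+ J I I ⟨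
    (I + I) * J        ∎
    where
    open ≡-Reasoning
    regroup : ∀ k l → k + l + l + k ≡ (k + l) + (k + l)
    regroup = solve-∀

  l+k≡IJ : l + k ≡ I * J
  l+k≡IJ = trans (+-comm l k) k+l≡IJ

  -- The shift `l ∸ 1` must be a true subtraction.
  longer-positive : ∀ {a b} → a ≤ b → a + b ≡ I * J → 1 ≤ b
  longer-positive {b = suc _} _ _ = s≤s z≤n
  longer-positive {b = zero} z≤n eq = subst (1 ≤_) (sym eq) 1≤IJ

  mirrored : ∀ s i → Split l 1 k (suc (I * J + 1) ∸ r s i)
  mirrored s i = Split-mirror (insert-one k l k+l≡IJ) (split s i)

  by-cases : k ≤ l ⊎ l ≤ k → DGR (I + I) J ((I + I) * J)
  by-cases (inj₁ k≤l) = subst (DGR _ _) (total k l k+l≡IJ)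
    (IsDGR-double-short-low (longer-positive k≤l k+l≡IJ) k≤l d split (IsDGR-mirror d) mirrored)
  -- The lower part is the longer one, so the mirror image goes first.
  by-cases (inj₂ l≤k) = subst (DGR _ _) (total l k l+k≡IJ)
    (IsDGR-double-short-low (longer-positive l≤k l+k≡IJ) l≤k (IsDGR-mirror d) mirrored d split)

-- Widening the gap from 1 to `m` makes every difference across it at least `m + 1`, whereas those
-- inside the two parts are at most `m`.
IsDGR-insert : ∀ {I I′ J n m r} {k l : ℕ} → 1 ≤ m → k ≤ suc m → l ≤ suc m →
  IsDGR I J n r → (∀ s i → Split k 1 l (r s i)) →
  DGR I′ J m → DGR (I + I′) J (k + l + m)
IsDGR-insert {m = m} {k = k} {l} 1≤m k≤ l≤ d split (r′ , d′) =
  subst (DGR _ _) (shuffle k l m)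
    -- The inserted family has an empty upper part; its formal gap `l` merely reserves the place of
    -- B.
    (interlace {h′ = l} {β′ = 0} (m ∸ 1) 0 gap refl
      (inj₂ (subst (λ x → k ≤ suc x) (sym gap) k≤ , subst (λ x → l ≤ suc x) (sym gap) l≤))
      (inj₁ refl) d split d′
      (λ s i → low (proj₁ (IsDGR.range d′ s i)) (proj₂ (IsDGR.range d′ s i))))
  where
  gap : m ∸ 1 + 1 ≡ m
  gap = m∸n+n≡m 1≤m

  shuffle : ∀ k l m → k + m + l + 0 ≡ k + l + m
  shuffle = solve-∀

IsDGR-fill : ∀ {I I′ J n m r} {k l : ℕ} → 1 ≤ m → m ≤ l →
  IsDGR I J n r → (∀ s i → Split k 1 l (r s i)) →
  DGR I′ J m → DGR (I + I′) J (k + l + m)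
IsDGR-fill {m = m} {k = k} {l} 1≤m m≤l d split (r′ , d′) =
  subst (DGR _ _) total
    -- The first family stays put. The second is cut between 1 and 2, a gap of width 0, and its
    -- upper part jumps over the `l` places of B.
    (interlace {α′ = 1} {h′ = 0} {β′ = m ∸ 1} 0 l refl (+-identityʳ l)
      (inj₁ refl)
      (inj₂ (s≤s z≤n , ≤-trans (m∸n≤m m 1) (≤-trans m≤l (≤-trans (m≤m+n l 0) (n≤1+n _)))))
      d split d′ split′)
  where
  1+[m∸1]≡m : 1 + (m ∸ 1) ≡ m
  1+[m∸1]≡m = m+[n∸m]≡n 1≤m

  split′ : ∀ s i → Split 1 0 (m ∸ 1) (r′ s i)
  split′ s i with r′ s i ≤? 1
  ... | yes r≤1 = low (proj₁ (IsDGR.range d′ s i)) r≤1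
  ... | no  r≰1 = high (≰⇒> r≰1)
    (≤-trans (proj₂ (IsDGR.range d′ s i)) (≤-reflexive (sym 1+[m∸1]≡m)))

  total : k + 1 + l + (m ∸ 1) ≡ k + l + m
  total = trans (shuffle k l (m ∸ 1)) (cong (k + l +_) 1+[m∸1]≡m)
    where
    shuffle : ∀ k l x → k + 1 + l + x ≡ k + l + (1 + x)
    shuffle = solve-∀

DGR-+ : ∀ {I I′ J} → 1 ≤ I′ * J → DGR I J (I * J + 1) → DGR I′ J (I′ * J) →
  DGR (I + I′) J ((I + I′) * J)
DGR-+ {I} {I′} {J} 1≤m (r , d) Q with missing-point d
... | k , l , k+l≡IJ , split = by-cases (k ≤? suc m) (l ≤? suc m)
  where
  m : ℕ
  m = I′ * J

  total : ∀ {x} → x ≡ I * J → x + m ≡ (I + I′) * J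
  total eq = trans (cong (_+ m) eq) (sym (*-distribʳ-+ J I I′))

  long : ∀ {x} → ¬ (x ≤ suc m) → m ≤ x
  long x≰ = ≤-trans (n≤1+n m) (<⇒≤ (≰⇒> x≰))

  by-cases : _ → _ → DGR (I + I′) J ((I + I′) * J)
  by-cases (yes k≤) (yes l≤) = subst (DGR _ _) (total k+l≡IJ) (IsDGR-insert 1≤m k≤ l≤ d split Q)
  by-cases _ (no l≰) = subst (DGR _ _) (total k+l≡IJ) (IsDGR-fill 1≤m (long l≰) d split Q)
  -- The long side lies below the missing point; the mirror image brings it above.
  by-cases (no k≰) (yes _) = subst (DGR _ _) (total (trans (+-comm l k) k+l≡IJ))
    (IsDGR-fill 1≤m (long k≰) (IsDGR-mirror d) (λ s i → Split-mirror (insert-one k l k+l≡IJ) (split s i)) Q)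

-- Parity and the range of I

even∨odd : ∀ n → ∃[ k ] (n ≡ k + k ⊎ n ≡ suc (k + k))
even∨odd zero = 0 , inj₁ refl
even∨odd (suc n) with even∨odd n
... | k , inj₁ refl = k , inj₂ refl
... | k , inj₂ refl = suc k , inj₁ (cong suc (sym (+-suc k k)))

2∣n⇒2∤1+n : ∀ {n} → 2 ∣ n → 2 ∤ suc n
2∣n⇒2∤1+n {n} 2∣n 2∣1+n with ∣1⇒≡1 (∣m+n∣m⇒∣n (subst (2 ∣_) (+-comm 1 n) 2∣1+n) 2∣n)
... | ()

-- The extra 1 lets the same lemma halve the lower bound on `I` for both parities.
double-≤ : ∀ {a b} → 2 * a ≤ suc (b + b) → a ≤ b
double-≤ {a} {b} le = ≮⇒≥ λ b<a → <⇒≱ (begin-strict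
  suc (b + b)    <⟨ n<1+n _ ⟩
  suc (suc (b + b)) ≡⟨ shuffle b ⟩
  2 * suc b      ≤⟨ *-monoʳ-≤ 2 b<a ⟩
  2 * a          ∎) le
  where
  open ≤-Reasoning
  shuffle : ∀ b → suc (suc (b + b)) ≡ 2 * suc b
  shuffle = solve-∀

theorem7 : ∀ (I₁ I₂ J : ℕ) → 1 ≤ I₁ → 1 ≤ I₂ → 3 ≤ J → I₁ < I₂ →
    (∀ i → I₁ ≤ i → i ≤ I₂ → 2 ∣ i → ∃[ h ] (IsH i J h × h ≤ i * J + 1)) →
    (∀ i → I₁ ≤ i → i ≤ I₂ → 2 ∤ i → IsH i J (i * J)) →
    ∀ I → 2 * I₁ ≤ I → I ≤ 2 * I₂ → IsH I J (I * J)
theorem7 I₁ I₂ J 1≤I₁ _ 3≤J _ evens odds I 2I₁≤I I≤2I₂ = record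
  { positive = *-mono-≤ (≤-trans 1≤I₁ (≤-trans (m≤m+n I₁ _) 2I₁≤I)) 1≤J
  ; exists   = exists I 2I₁≤I I≤2I₂ (even∨odd I)
  ; least    = λ n _ → I*J≤n
  }
  where
  1≤J : 1 ≤ J
  1≤J = ≤-trans (s≤s z≤n) 3≤J

  1≤iJ : ∀ {i} → I₁ ≤ i → 1 ≤ i * J
  1≤iJ I₁≤i = *-mono-≤ (≤-trans 1≤I₁ I₁≤i) 1≤J

  -- A perfect family also counts as one with a spare point, so doubling works for either parity of
  -- `i`.
  almost : ∀ i → I₁ ≤ i → i ≤ I₂ → DGR i J (i * J + 1)
  almost i lo up with 2 ∣? i
  ... | yes 2∣i with evens i lo up 2∣i
  ...   | h , isH , h≤ = proj₁ (IsH.exists isH) , IsDGR-weaken h≤ (proj₂ (IsH.exists isH))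
  almost i lo up | no 2∤i with IsH.exists (odds i lo up 2∤i)
  ...   | r , d = r , IsDGR-weaken (m≤m+n (i * J) 1) d

  -- Of `i` and `i + 1` the odd one supplies the perfect family and the even one the family with a
  -- missing point.
  consecutive : ∀ i → I₁ ≤ i → suc i ≤ I₂ → DGR (suc (i + i)) J (suc (i + i) * J)
  consecutive i lo up with 2 ∣? i
  ... | yes 2∣i = subst (λ I → DGR I J (I * J)) (+-suc i i)
    (DGR-+ (1≤iJ (m≤n⇒m≤1+n lo)) (almost i lo (<⇒≤ up))
      (IsH.exists (odds (suc i) (m≤n⇒m≤1+n lo) up (2∣n⇒2∤1+n 2∣i))))
  ... | no 2∤i = DGR-+ (1≤iJ lo) (almost (suc i) (m≤n⇒m≤1+n lo) up)
      (IsH.exists (odds i lo (<⇒≤ up) 2∤i))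

  exists : ∀ I → 2 * I₁ ≤ I → I ≤ 2 * I₂ → ∃[ k ] (I ≡ k + k ⊎ I ≡ suc (k + k)) →
    DGR I J (I * J)
  exists _ lo up (k , inj₁ refl) = DGR-double (1≤iJ I₁≤k) (almost k I₁≤k k≤I₂)
    where
    I₁≤k : I₁ ≤ k
    I₁≤k = double-≤ (m≤n⇒m≤1+n lo)
    k≤I₂ : k ≤ I₂
    k≤I₂ = *-cancelˡ-≤ 2 (subst (_≤ 2 * I₂) (cong (k +_) (sym (+-identityʳ k))) up)
  exists _ lo up (k , inj₂ refl) = consecutive k (double-≤ lo)
    (*-cancelˡ-< 2 k I₂ (subst (_≤ 2 * I₂) (cong (λ x → suc (k + x)) (sym (+-identityʳ k))) up))
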